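{- Let $m$ be a positive integer and let $A=\{a_s(n_s)\}_{s=1}^k$ be a finite system of residue classes, where $a_s\in\mathbb{Z}$, $n_s$ is a positive integer and $a_s(n_s)=a_s+n_s\mathbb{Z}$, such that $A$ forms an $m$-cover of $\mathbb{Z}$. Let $m_1,\ldots,m_k$ be any integers. Then for any real $\theta$ with $0\le\theta<1$, the set $$I_A(\theta)=\Big\{I\subseteq\{1,\ldots,k\}:\ \Big\{\sum_{s\in I}\frac{m_s}{n_s}\Big\}=\theta\Big\}$$ is either empty or has at least $2^m$ elements.
   Context: A finite system $\{a_s(n_s)\}_{s=1}^k$ is an $m$-cover of $\mathbb{Z}$ if every integer lies in at least $m$ of the sets $a_s+n_s\mathbb{Z}$ (counted with multiplicity over $s=1,\ldots,k$). For a real number $\alpha$, $\{\alpha\}$ denotes its fractional part $\alpha-\lfloor\alpha\rfloor$. -}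

module Defs where

open import Data.Nat as ℕ using (ℕ; zero; suc)
open import Data.Integer as ℤ using (ℤ; +_)
open import Data.Integer.Divisibility.Signed using (_∣?_)
open import Data.Rational as ℚ using (ℚ; 0ℚ; floor)
open import Data.Rational.Properties as ℚP using ()
open import Data.Fin using (Fin)
open import Data.Fin.Subset using (Subset)
open import Data.Fin.Subset.Properties using (_∈?_)
open import Data.Bool using (true; false)
open import Data.Vec using ([]; _∷_)
open import Data.List as List using (List; length; filter; foldr; map; _++_; [_])

frac : ℚ → ℚ
frac q = q ℚ.- (floor q ℚ./ 1)

-- integer divided by natural number (value 0 for denominator 0; only used
-- with positive denominators)
_/ᵣ_ : ℤ → ℕ → ℚ
q /ᵣ zero = 0ℚ
q /ᵣ suc d = q ℚ./ suc d

coverCount : {k : ℕ} → (Fin k → ℤ) → (Fin k → ℕ) → ℤ → ℕ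
coverCount {k} a n x = length (filter (λ s → (+ n s) ∣? (x ℤ.- a s)) (List.allFin k))

IsMCover : (m : ℕ) {k : ℕ} → (Fin k → ℤ) → (Fin k → ℕ) → Set
IsMCover m a n = ∀ (x : ℤ) → m ℕ.≤ coverCount a n x

allSubsets : (k : ℕ) → List (Subset k)
allSubsets zero = [ [] ]
allSubsets (suc k) = map (true ∷_) (allSubsets k) ++ map (false ∷_) (allSubsets k)

sumOver : {k : ℕ} → Subset k → (Fin k → ℚ) → ℚ
sumOver {k} I f = foldr (λ s acc → f s ℚ.+ acc) 0ℚ (filter (λ s → s ∈? I) (List.allFin k))

countIA : {k : ℕ} → (Fin k → ℕ) → (Fin k → ℤ) → ℚ → ℕ
countIA {k} n ms θ =
  length (filter (λ I → frac (sumOver I (λ s → ms s /ᵣ n s)) ℚP.≟ θ) (allSubsets k))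

{-# OPTIONS --safe #-}

-- Let N be a common multiple of the moduli, d_s = m_s N / n_s and D(I) = ∑_{s∈I} d_s, and fix I₀ in I_A(θ),
-- so that N ∣ D(I) - D(I₀) implies I ∈ I_A(θ).  With ζ a primitive N-th root of unity, the function
--   g(I) = (-1)^|I| ∑_{x<N} ζ^(∑_{s∈I} (x - a_s) d_s - x D(I₀))
-- is supported on I_A(θ) and nonzero at I₀.  For fixed x at least m of the factors 1 - ζ^((x - a_s) d_s) of
-- the generating product vanish, so g is orthogonal to all polynomials of degree < m on the cube {0,1}^k,
-- and a nonzero function with this property has at least 2^m points in its support.
-- Roots of unity are avoided: only translates of u ↦ ζ^u enter, so ζ^u may be replaced by any N-periodic
-- integer function h with h(0) ≠ 0 whose sum over each coset of a nontrivial subgroup of ℤ/N is zero.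

module Submission where

open import Defs
open import Data.Nat as ℕ using (ℕ; zero; suc; _^_; _≤_; _<_; z≤n; s≤s; s≤s⁻¹)
import Data.Nat.Properties as ℕP
import Data.Nat.Divisibility as ℕD
open import Data.Nat.GCD using (module Bézout; gcd; gcd-GCD; gcd[m,n]∣m; gcd[m,n]∣n)
open import Data.Nat.ListAction using (product)
open import Data.Nat.ListAction.Properties using (∈⇒∣product; product≢0)
open import Data.Nat.Primality
  using (Prime; euclidsLemma; prime⇒nonZero; prime⇒irreducible; ¬prime[1])
open import Data.Nat.Primality.Factorisation using (factorise; module PrimeFactorisation)
open import Data.Integer as ℤ
  using (ℤ; +_; -[1+_]; _+_; _*_; _-_; -_; 0ℤ; 1ℤ; ∣_∣)
import Data.Integer.Properties as ℤP
open import Data.Integer.DivMod using ([n/d]*d≤n; n<s[n/ℕd]*d; div-pos-is-/ℕ)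
open import Data.Integer.Divisibility.Signed
  using (_∣_; divides; _∣?_; ∣-refl; ∣⇒∣ᵤ; ∣ᵤ⇒∣; ∣m+n∣n⇒∣m; ∣n⇒∣m*n; ∣m⇒∣m*n; m∣∣m∣)
open import Data.Integer.Tactic.RingSolver using (solve-∀)
open import Data.Rational as ℚ using (ℚ; 0ℚ; 1ℚ; floor; ↥_; ↧_; toℚᵘ)
import Data.Rational.Properties as ℚP
open import Data.Rational.Solver using (module +-*-Solver)
open import Data.Rational.Unnormalised as ℚᵘ using (mkℚᵘ; *≡*; _≃_)
import Data.Rational.Unnormalised.Properties as ℚᵘP
open import Data.Bool using (true; false)
open import Data.Fin using (Fin; zero; suc)
open import Data.Fin.Subset using (Subset)
open import Data.Fin.Subset.Properties using (_∈?_)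
open import Data.List using (List; []; _∷_; length; filter; foldr; map; _++_; tabulate)
open import Data.List.Membership.Propositional.Properties using (∈-tabulate⁺)
open import Data.List.Properties using (length-++; filter-++)
open import Data.List.Relation.Unary.All using (All; []; _∷_)
open import Data.List.Relation.Unary.All.Properties using (all-filter; tabulate⁺)
open import Data.Product using (∃; ∃₂; _×_; _,_)
open import Data.Sum using (_⊎_; inj₁; inj₂; [_,_]′)
open import Data.Unit using (⊤; tt)
open import Data.Vec using ([]; _∷_; lookup)
open import Function using (_∘_; id)
open import Level using (0ℓ)
open import Relation.Nullary using (¬_; yes; no; does; contradiction)
open import Relation.Unary using (Pred; Decidable)
open import Relation.Binary.PropositionalEquality
  using (_≡_; _≢_; refl; sym; trans; cong; cong₂; subst; module ≡-Reasoning)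
open import Algebra.Properties.AbelianGroup ℤP.+-0-abelianGroup
  using () renaming (∙-cancelˡ to +-cancelˡ)

-- Floor and fractional part under integer translation.

floor-lower : ∀ q → floor q * ↧ q ℤ.≤ ↥ q
floor-lower q@record{} = [n/d]*d≤n (↥ q) (↧ q)

floor-upper : ∀ q → ↥ q ℤ.< ℤ.suc (floor q) * ↧ q
floor-upper q@record{} = subst (λ f → ↥ q ℤ.< ℤ.suc f * ↧ q)
  (sym (div-pos-is-/ℕ (↥ q) (ℚ.↧ₙ q))) (n<s[n/ℕd]*d (↥ q) (ℚ.↧ₙ q))

-- The equation is `r = q + z` with denominators cleared. Multiplied by both denominators, the chain
-- is `floor r ≤ r = q + z < floor q + 1 + z`, and strictness between integers absorbs the 1. This
-- form serves `z` and `- z` alike.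
floor-≤ : ∀ q r z → ↥ r * ↧ q ≡ (↥ q + z * ↧ q) * ↧ r → floor r ℤ.≤ floor q + z
floor-≤ q r z eq = subst (floor r ℤ.≤_) (trans (cong ℤ.pred (ℤP.+-assoc 1ℤ (floor q) z)) (ℤP.pred-suc (floor q + z)))
  (ℤP.i<j⇒i≤pred[j] {j = ℤ.suc (floor q) + z} (ℤP.*-cancelʳ-<-nonNeg (↧ r * ↧ q) chain))
  where
  open ℤP.≤-Reasoning
  lemma : ∀ f z q r → (f * q + z * q) * r ≡ (f + z) * (r * q)
  lemma = solve-∀
  chain : floor r * (↧ r * ↧ q) ℤ.< (ℤ.suc (floor q) + z) * (↧ r * ↧ q)
  chain = begin-strict
    floor r * (↧ r * ↧ q)                         ≡⟨ ℤP.*-assoc (floor r) (↧ r) (↧ q) ⟨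
    floor r * ↧ r * ↧ q                           ≤⟨ ℤP.*-monoʳ-≤-nonNeg (↧ q) (floor-lower r) ⟩
    ↥ r * ↧ q                                     ≡⟨ eq ⟩
    (↥ q + z * ↧ q) * ↧ r                         <⟨ ℤP.*-monoʳ-<-pos (↧ r) (ℤP.+-monoˡ-< (z * ↧ q) (floor-upper q)) ⟩
    (ℤ.suc (floor q) * ↧ q + z * ↧ q) * ↧ r       ≡⟨ lemma (ℤ.suc (floor q)) z (↧ q) (↧ r) ⟩
    (ℤ.suc (floor q) + z) * (↧ r * ↧ q)           ∎

open ≡-Reasoning

/-cross : ∀ i j m n → i * + suc n ≡ j * + suc m → i ℚ./ suc m ≡ j ℚ./ suc n
/-cross i j m n eq = ℚP.fromℚᵘ-cong {mkℚᵘ i m} {mkℚᵘ j n} (*≡* eq)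

toℚᵘ-/+/ : ∀ i m j n → toℚᵘ (i ℚ./ suc m ℚ.+ j ℚ./ suc n) ≃ mkℚᵘ i m ℚᵘ.+ mkℚᵘ j n
toℚᵘ-/+/ i m j n = ℚᵘP.≃-trans (ℚP.toℚᵘ-homo-+ (i ℚ./ suc m) (j ℚ./ suc n))
  (ℚᵘP.+-cong (ℚP.toℚᵘ-fromℚᵘ (mkℚᵘ i m)) (ℚP.toℚᵘ-fromℚᵘ (mkℚᵘ j n)))

/-distrib-+ : ∀ i j n → i ℚ./ suc n ℚ.+ j ℚ./ suc n ≡ (i + j) ℚ./ suc n
/-distrib-+ i j n = ℚP.toℚᵘ-injective (ℚᵘP.≃-trans (toℚᵘ-/+/ i n j n)
  (ℚᵘP.≃-trans (*≡* (lemma i j (+ suc n)))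
               (ℚᵘP.≃-sym (ℚP.toℚᵘ-fromℚᵘ (mkℚᵘ (i + j) n)))))
  where
  lemma : ∀ i j n → (i * n + j * n) * n ≡ (i + j) * (n * n)
  lemma = solve-∀

-- Addition in `ℚ` normalises, so the relation is obtained from the unnormalised fractions, where it
-- is an equality of cross products.
↥-+-integer : ∀ q z r → r ≡ q ℚ.+ z ℚ./ 1 → ↥ r * ↧ q ≡ (↥ q + z * ↧ q) * ↧ r
↥-+-integer q@record{} z r@record{} refl′
  with *≡* eq ← ℚᵘP.≃-trans (ℚP.toℚᵘ-cong refl′) (ℚᵘP.≃-trans (ℚP.toℚᵘ-homo-+ q (z ℚ./ 1))
                  (ℚᵘP.+-congʳ (toℚᵘ q) (ℚP.toℚᵘ-fromℚᵘ (mkℚᵘ z 0)))) = begin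
  ↥ r * ↧ q                    ≡⟨ cong (λ d → ↥ r * + d) (ℕP.*-identityʳ (ℚ.↧ₙ q)) ⟨
  ↥ r * + (ℚ.↧ₙ q ℕ.* 1)       ≡⟨ eq ⟩
  (↥ q * 1ℤ + z * ↧ q) * ↧ r   ≡⟨ cong (λ n → (n + z * ↧ q) * ↧ r) (ℤP.*-identityʳ (↥ q)) ⟩
  (↥ q + z * ↧ q) * ↧ r        ∎

floor-+-integer : ∀ q z → floor (q ℚ.+ z ℚ./ 1) ≡ floor q + z
floor-+-integer q z = ℤP.≤-antisym (floor-≤ q r z r≡q+z)
  (subst (floor q + z ℤ.≤_) (cancel (floor r) z) (ℤP.+-monoˡ-≤ z (floor-≤ r q (- z) q≡r-z)))
  where
  r : ℚ
  r = q ℚ.+ z ℚ./ 1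
  cancel : ∀ a z → a + - z + z ≡ a
  cancel = solve-∀
  r≡q+z : ↥ r * ↧ q ≡ (↥ q + z * ↧ q) * ↧ r
  r≡q+z = ↥-+-integer q z r refl
  q≡r-z : ↥ q * ↧ r ≡ (↥ r + - z * ↧ r) * ↧ q
  q≡r-z = begin
    ↥ q * ↧ r                                ≡⟨ lemma (↥ q) (↧ q) (↧ r) z ⟩
    (↥ q + z * ↧ q) * ↧ r - z * ↧ r * ↧ q    ≡⟨ cong (λ n → n - z * ↧ r * ↧ q) r≡q+z ⟨
    ↥ r * ↧ q - z * ↧ r * ↧ q                ≡⟨ lemma′ (↥ r) (↧ q) (↧ r) z ⟩
    (↥ r + - z * ↧ r) * ↧ q                  ∎
    where
    lemma : ∀ a q r z → a * r ≡ (a + z * q) * r - z * r * q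
    lemma = solve-∀
    lemma′ : ∀ b q r z → b * q - z * r * q ≡ (b + - z * r) * q
    lemma′ = solve-∀

frac-+-integer : ∀ q z → frac (q ℚ.+ z ℚ./ 1) ≡ frac q
frac-+-integer q z = begin
  q ℚ.+ z/1 ℚ.- floor (q ℚ.+ z/1) ℚ./ 1   ≡⟨ cong (λ f → q ℚ.+ z/1 ℚ.- f ℚ./ 1) (floor-+-integer q z) ⟩
  q ℚ.+ z/1 ℚ.- (floor q + z) ℚ./ 1       ≡⟨ cong (λ f → q ℚ.+ z/1 ℚ.- f) (/-distrib-+ (floor q) z 0) ⟨
  q ℚ.+ z/1 ℚ.- (floor q ℚ./ 1 ℚ.+ z/1)   ≡⟨ solve 3 (λ a b c → a :+ b :- (c :+ b) := a :- c) refl q z/1 (floor q ℚ./ 1) ⟩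
  q ℚ.- floor q ℚ./ 1                     ∎
  where
  open +-*-Solver
  z/1 : ℚ
  z/1 = z ℚ./ 1

-- Finite sums of integers.

∑ : ℕ → (ℕ → ℤ) → ℤ
∑ zero    f = 0ℤ
∑ (suc n) f = f 0 + ∑ n (f ∘ suc)

∑-cong : ∀ n {f g : ℕ → ℤ} → (∀ i → f i ≡ g i) → ∑ n f ≡ ∑ n g
∑-cong zero    f≗g = refl
∑-cong (suc n) f≗g = cong₂ _+_ (f≗g 0) (∑-cong n (f≗g ∘ suc))

∑-const : ∀ n c → ∑ n (λ _ → c) ≡ + n * c
∑-const zero    c = sym (ℤP.*-zeroˡ c)
∑-const (suc n) c = begin
  c + ∑ n (λ _ → c)   ≡⟨ cong (_+_ c) (∑-const n c) ⟩
  c + + n * c         ≡⟨ ℤP.suc-* (+ n) c ⟨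
  + suc n * c         ∎

∑-zero : ∀ n {f : ℕ → ℤ} → (∀ i → f i ≡ 0ℤ) → ∑ n f ≡ 0ℤ
∑-zero n f≗0 = trans (∑-cong n f≗0) (trans (∑-const n 0ℤ) (ℤP.*-zeroʳ (+ n)))

∑-+ : ∀ n (f g : ℕ → ℤ) → ∑ n (λ i → f i + g i) ≡ ∑ n f + ∑ n g
∑-+ zero    f g = refl
∑-+ (suc n) f g rewrite ∑-+ n (f ∘ suc) (g ∘ suc) =
  interchange (f 0) (g 0) (∑ n (f ∘ suc)) (∑ n (g ∘ suc))
  where
  interchange : ∀ a b c d → a + b + (c + d) ≡ a + c + (b + d)
  interchange = solve-∀

∑-*ˡ : ∀ n c (f : ℕ → ℤ) → ∑ n (λ i → c * f i) ≡ c * ∑ n f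
∑-*ˡ zero    c f = sym (ℤP.*-zeroʳ c)
∑-*ˡ (suc n) c f rewrite ∑-*ˡ n c (f ∘ suc) = sym (ℤP.*-distribˡ-+ c (f 0) _)

∑-- : ∀ n (f g : ℕ → ℤ) → ∑ n (λ i → f i - g i) ≡ ∑ n f - ∑ n g
∑-- zero    f g = refl
∑-- (suc n) f g rewrite ∑-- n (f ∘ suc) (g ∘ suc) =
  interchange (f 0) (g 0) (∑ n (f ∘ suc)) (∑ n (g ∘ suc))
  where
  interchange : ∀ a b c d → a - b + (c - d) ≡ a + c - (b + d)
  interchange = solve-∀

∑-swap : ∀ m n (f : ℕ → ℕ → ℤ) →
         ∑ m (λ i → ∑ n (f i)) ≡ ∑ n (λ j → ∑ m (λ i → f i j))
∑-swap zero    n f = sym (∑-zero n (λ _ → refl))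
∑-swap (suc m) n f rewrite ∑-swap m n (f ∘ suc) =
  sym (∑-+ n (f 0) (λ j → ∑ m (λ i → f (suc i) j)))

∑-last : ∀ n (f : ℕ → ℤ) → ∑ (suc n) f ≡ ∑ n f + f n
∑-last zero    f = ℤP.+-comm (f 0) 0ℤ
∑-last (suc n) f = begin
  f 0 + ∑ (suc n) (f ∘ suc)          ≡⟨ cong (_+_ (f 0)) (∑-last n (f ∘ suc)) ⟩
  f 0 + (∑ n (f ∘ suc) + f (suc n))  ≡⟨ ℤP.+-assoc (f 0) _ _ ⟨
  ∑ (suc n) f + f (suc n)            ∎

∑-rotate : ∀ n (f : ℕ → ℤ) → f n ≡ f 0 → ∑ n (f ∘ suc) ≡ ∑ n f
∑-rotate n f fn≡f0 = +-cancelˡ (f 0) _ _ (begin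
  f 0 + ∑ n (f ∘ suc)  ≡⟨ ∑-last n f ⟩
  ∑ n f + f n          ≡⟨ cong (_+_ (∑ n f)) fn≡f0 ⟩
  ∑ n f + f 0          ≡⟨ ℤP.+-comm (∑ n f) (f 0) ⟩
  f 0 + ∑ n f          ∎)

-- Periods of functions on the integers.

Period : (ℤ → ℤ) → ℤ → Set
Period f a = ∀ u → f (u + a) ≡ f u

period-neg : ∀ {f a} → Period f a → Period f (- a)
period-neg {f} {a} per u = begin
  f (u + - a)      ≡⟨ per (u + - a) ⟨
  f (u + - a + a)  ≡⟨ cong f (cancel u a) ⟩
  f u              ∎
  where
  cancel : ∀ u a → u + - a + a ≡ u
  cancel = solve-∀

period-ℕ* : ∀ {f a} → Period f a → ∀ n → Period f (+ n * a)
period-ℕ* {f} {a} per zero    u = cong f (trans (cong (_+_ u) (ℤP.*-zeroˡ a)) (ℤP.+-identityʳ u))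
period-ℕ* {f} {a} per (suc n) u = begin
  f (u + + suc n * a)    ≡⟨ cong (λ v → f (u + v)) (ℤP.suc-* (+ n) a) ⟩
  f (u + (a + + n * a))  ≡⟨ cong f (ℤP.+-assoc u a (+ n * a)) ⟨
  f (u + a + + n * a)    ≡⟨ period-ℕ* per n (u + a) ⟩
  f (u + a)              ≡⟨ per u ⟩
  f u                    ∎

period-∣ : ∀ {f a b} → Period f a → a ∣ b → Period f b
period-∣ {f} {a} per (divides (+ n) refl) = period-ℕ* per n
period-∣ {f} {a} per (divides (-[1+ n ]) refl) =
  subst (Period f) (ℤP.neg-distribˡ-* (+ suc n) a) (period-neg (period-ℕ* per (suc n)))

-- Construction of the substitute for a root of unity, one prime factor at a time.

-- An integer-valued stand-in for u ↦ ζ^u with ζ a primitive N-th root of unity.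
record PrimitiveFunction (N : ℕ) : Set where
  field
    h        : ℤ → ℤ
    periodic : Period h (+ N)
    h0≢0     : h 0ℤ ≢ 0ℤ
    vanish   : ∀ p M → Prime p → N ≡ p ℕ.* M →
               ∀ u → ∑ p (λ i → h (u + + i * + M)) ≡ 0ℤ

-- For `h` of period `M`, this is the pushforward of `h` along multiplication by `p`, which embeds
-- ℤ/M into ℤ/pM.
dilate : ℕ → (ℤ → ℤ) → ℤ → ℤ
dilate p h u with + p ∣? u
... | yes (divides q _) = h q
... | no  _             = 0ℤ

dilate-∣ : ∀ p .{{_ : ℕ.NonZero p}} h v → dilate p h (v * + p) ≡ h v
dilate-∣ p@(suc _) h v with + p ∣? v * + p
... | yes (divides q eq) = cong h (ℤP.*-cancelʳ-≡ q v (+ p) (sym eq))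
... | no  ∤              = contradiction (divides v refl) ∤

dilate-∤ : ∀ p h {u} → ¬ (+ p ∣ u) → dilate p h u ≡ 0ℤ
dilate-∤ p h {u} ∤ with + p ∣? u
... | yes p∣u = contradiction p∣u ∤
... | no  _   = refl

dilate-periodic : ∀ p .{{_ : ℕ.NonZero p}} {h M} → Period h (+ M) → Period (dilate p h) (+ (p ℕ.* M))
dilate-periodic p {h} {M} per u with + p ∣? u
... | no ∤ = dilate-∤ p h λ p∣ → ∤ (∣m+n∣n⇒∣m p∣ (∣ᵤ⇒∣ (ℕD.m∣m*n M)))
... | yes (divides v refl) = begin
  dilate p h (v * + p + + (p ℕ.* M))  ≡⟨ cong (dilate p h) (trans (cong (_+_ (v * + p)) (ℤP.pos-* p M)) (factor v (+ p) (+ M))) ⟩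
  dilate p h ((v + + M) * + p)        ≡⟨ dilate-∣ p h (v + + M) ⟩
  h (v + + M)                         ≡⟨ per v ⟩
  h v                                 ∎
  where
  factor : ∀ v p M → v * p + p * M ≡ (v + M) * p
  factor = solve-∀

-- A step `p L` preserves divisibility by `p`: the progression either misses all multiples of `p`,
-- or is `p` times a progression of step `L`.
dilate-vanish : ∀ p .{{_ : ℕ.NonZero p}} {h : ℤ → ℤ} q L →
                (∀ u → ∑ q (λ i → h (u + + i * + L)) ≡ 0ℤ) →
                ∀ u → ∑ q (λ i → dilate p h (u + + i * + (p ℕ.* L))) ≡ 0ℤ
dilate-vanish p {h} q L van u with + p ∣? u
... | no ∤ = ∑-zero q λ i → dilate-∤ p h λ p∣ →
               ∤ (∣m+n∣n⇒∣m p∣ (∣n⇒∣m*n (+ i) (∣ᵤ⇒∣ (ℕD.m∣m*n L))))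
... | yes (divides v refl) = trans (∑-cong q step) (van v)
  where
  factor : ∀ v p i L → v * p + i * (p * L) ≡ (v + i * L) * p
  factor = solve-∀
  step : ∀ i → dilate p h (v * + p + + i * + (p ℕ.* L)) ≡ h (v + + i * + L)
  step i = begin
    dilate p h (v * + p + + i * + (p ℕ.* L))  ≡⟨ cong (λ z → dilate p h (v * + p + + i * z)) (ℤP.pos-* p L) ⟩
    dilate p h (v * + p + + i * (+ p * + L))  ≡⟨ cong (dilate p h) (factor v (+ p) (+ i) (+ L)) ⟩
    dilate p h ((v + + i * + L) * + p)        ≡⟨ dilate-∣ p h (v + + i * + L) ⟩
    h (v + + i * + L)                         ∎

primitiveFunction-1 : PrimitiveFunction 1
primitiveFunction-1 = record
  { h        = λ _ → 1ℤ
  ; periodic = λ _ → refl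
  ; h0≢0     = λ ()
  ; vanish   = λ p M pp 1≡pM → contradiction
                 (subst Prime (ℕP.m*n≡1⇒m≡1 p M (sym 1≡pM)) pp) ¬prime[1]
  }

prime∣prime : ∀ {p q} → Prime p → Prime q → q ℕD.∣ p → q ≡ p
prime∣prime pp pq q∣p with prime⇒irreducible pp q∣p
... | inj₁ refl = contradiction pq ¬prime[1]
... | inj₂ q≡p  = q≡p

module _ {p M : ℕ} (pp : Prime p) (pf : PrimitiveFunction M) where
  open PrimitiveFunction pf

  private
    instance
      p≢0 : ℕ.NonZero p
      p≢0 = prime⇒nonZero pp

    k : ℤ → ℤ
    k = dilate p h

    k-periodic : Period k (+ (p ℕ.* M))
    k-periodic = dilate-periodic p {h} {M} periodic

    k0≢0 : k 0ℤ ≢ 0ℤ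
    k0≢0 = subst (_≢ 0ℤ) (sym (dilate-∣ p h 0ℤ)) h0≢0

    -- Writing `M = L q` gives `M′ = p L`, so the relation for `q` at level `M` passes through the
    -- dilation. The case `q = p` is included.
    k-vanish : ∀ q M′ → Prime q → p ℕ.* M ≡ q ℕ.* M′ → q ℕD.∣ M →
               ∀ u → ∑ q (λ i → k (u + + i * + M′)) ≡ 0ℤ
    k-vanish q M′ pq pM≡qM′ (ℕD.divides L M≡Lq) u =
      trans (cong (λ z → ∑ q (λ i → k (u + + i * + z))) M′≡pL)
            (dilate-vanish p q L (vanish q L pq (trans M≡Lq (ℕP.*-comm L q))) u)
      where
      instance
        q≢0 : ℕ.NonZero q
        q≢0 = prime⇒nonZero pq
      M′≡pL : M′ ≡ p ℕ.* L
      M′≡pL = ℕP.*-cancelʳ-≡ M′ (p ℕ.* L) q (begin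
        M′ ℕ.* q          ≡⟨ ℕP.*-comm M′ q ⟩
        q ℕ.* M′          ≡⟨ pM≡qM′ ⟨
        p ℕ.* M           ≡⟨ cong (p ℕ.*_) M≡Lq ⟩
        p ℕ.* (L ℕ.* q)   ≡⟨ ℕP.*-assoc p L q ⟨
        p ℕ.* L ℕ.* q     ∎)

    euclid : ∀ {q M′} → Prime q → p ℕ.* M ≡ q ℕ.* M′ → q ≡ p ⊎ q ℕD.∣ M
    euclid {q} {M′} pq eq with euclidsLemma p M pq (subst (q ℕD.∣_) (sym eq) (ℕD.m∣m*n M′))
    ... | inj₁ q∣p = inj₁ (prime∣prime pp pq q∣p)
    ... | inj₂ q∣M = inj₂ q∣M

    Δk : ℤ → ℤ
    Δk u = k u - k (u - + M)

    Δk-periodic : Period Δk (+ (p ℕ.* M))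
    Δk-periodic u = cong₂ _-_ (k-periodic u)
      (trans (cong k (shuffle u (+ (p ℕ.* M)) (+ M))) (k-periodic (u - + M)))
      where
      shuffle : ∀ u a b → u + a - b ≡ u - b + a
      shuffle = solve-∀

    -- Translation by `M` permutes the residues `u + i M` modulo `p M` cyclically, so the two sums
    -- being subtracted agree.
    Δk-vanish-new : ∀ u → ∑ p (λ i → Δk (u + + i * + M)) ≡ 0ℤ
    Δk-vanish-new u = begin
      ∑ p (λ i → Δk (u + + i * + M))
        ≡⟨ ∑-- p (λ i → k (u + + i * + M)) (λ i → k (u + + i * + M - + M)) ⟩
      ∑ p (λ i → k (u + + i * + M)) - ∑ p f
        ≡⟨ cong (_- ∑ p f) (trans (∑-cong p λ i → sym (f-suc i)) (∑-rotate p f fp≡f0)) ⟩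
      ∑ p f - ∑ p f
        ≡⟨ ℤP.+-inverseʳ (∑ p f) ⟩
      0ℤ ∎
      where
      f : ℕ → ℤ
      f i = k (u + + i * + M - + M)
      f-suc : ∀ i → f (suc i) ≡ k (u + + i * + M)
      f-suc i = cong k (trans (cong (λ z → u + z - + M) (ℤP.suc-* (+ i) (+ M))) (lemma u (+ M) (+ i * + M)))
        where
        lemma : ∀ u M z → u + (M + z) - M ≡ u + z
        lemma = solve-∀
      fp≡f0 : f p ≡ f 0
      fp≡f0 = begin
        k (u + + p * + M - + M)              ≡⟨ cong (λ z → k (u + z - + M)) (ℤP.pos-* p M) ⟨
        k (u + + (p ℕ.* M) - + M)            ≡⟨ cong k (lemma u (+ M) (+ (p ℕ.* M))) ⟩
        k (u + 0ℤ * + M - + M + + (p ℕ.* M)) ≡⟨ k-periodic _ ⟩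
        k (u + 0ℤ * + M - + M)               ∎
        where
        lemma : ∀ u M z → u + z - M ≡ u + 0ℤ * M - M + z
        lemma = solve-∀

  -- Dilation alone handles the primes dividing M; when p ∤ M, the difference of two translates by M makes
  -- the sum belonging to p telescope.
  primitiveFunction-* : PrimitiveFunction (p ℕ.* M)
  primitiveFunction-* with p ℕD.∣? M
  ... | yes p∣M = record
    { h        = k
    ; periodic = k-periodic
    ; h0≢0     = k0≢0
    ; vanish   = van
    }
    where
    van : ∀ q M′ → Prime q → p ℕ.* M ≡ q ℕ.* M′ → ∀ u → ∑ q (λ i → k (u + + i * + M′)) ≡ 0ℤ
    van q M′ pq eq with euclid pq eq
    ... | inj₁ refl = k-vanish q M′ pq eq p∣M
    ... | inj₂ q∣M  = k-vanish q M′ pq eq q∣M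
  ... | no p∤M = record
    { h        = Δk
    ; periodic = Δk-periodic
    ; h0≢0     = subst (_≢ 0ℤ) (sym Δk0≡k0) k0≢0
    ; vanish   = van
    }
    where
    Δk0≡k0 : Δk 0ℤ ≡ k 0ℤ
    Δk0≡k0 = begin
      -- Since `p` does not divide `- M`, the subtracted translate vanishes at 0.
      k 0ℤ - k (0ℤ - + M) ≡⟨ cong (_-_ (k 0ℤ)) (dilate-∤ p h λ p∣ → p∤M (subst (p ℕD.∣_) (trans (cong ∣_∣ (ℤP.+-identityˡ (- + M))) (ℤP.∣-i∣≡∣i∣ (+ M))) (∣⇒∣ᵤ p∣))) ⟩
      k 0ℤ - 0ℤ           ≡⟨ ℤP.+-identityʳ (k 0ℤ) ⟩
      k 0ℤ                ∎
    van : ∀ q M′ → Prime q → p ℕ.* M ≡ q ℕ.* M′ → ∀ u → ∑ q (λ i → Δk (u + + i * + M′)) ≡ 0ℤ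
    van q M′ pq eq u with euclid pq eq
    ... | inj₁ refl rewrite sym (ℕP.*-cancelˡ-≡ M M′ p eq) = Δk-vanish-new u
    ... | inj₂ q∣M  = begin
      ∑ q (λ i → Δk (u + + i * + M′))
        ≡⟨ ∑-- q (λ i → k (u + + i * + M′)) (λ i → k (u + + i * + M′ - + M)) ⟩
      ∑ q (λ i → k (u + + i * + M′)) - ∑ q (λ i → k (u + + i * + M′ - + M))
        ≡⟨ cong₂ _-_ (k-vanish q M′ pq eq q∣M u)
             (trans (∑-cong q λ i → cong k (shuffle u (+ i * + M′) (+ M))) (k-vanish q M′ pq eq q∣M (u - + M))) ⟩
      0ℤ ∎
      where
      shuffle : ∀ u a b → u + a - b ≡ u - b + a
      shuffle = solve-∀

primitiveFunction-product : ∀ {ps} → All Prime ps → PrimitiveFunction (product ps)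
primitiveFunction-product []         = primitiveFunction-1
primitiveFunction-product (pp ∷ pps) = primitiveFunction-* pp (primitiveFunction-product pps)

primitiveFunction : ∀ N .{{_ : ℕ.NonZero N}} → PrimitiveFunction N
primitiveFunction N = subst PrimitiveFunction (sym isFactorisation) (primitiveFunction-product factorsPrime)
  where open PrimeFactorisation (factorise N)

-- Orbit sums, replacing sums of powers of a root of unity.

period-cancelʳ : ∀ {f a b} → Period f (a + b) → Period f b → Period f a
period-cancelʳ {f} {a} {b} per-a+b per-b u = begin
  f (u + a)        ≡⟨ per-b (u + a) ⟨
  f (u + a + b)    ≡⟨ cong f (ℤP.+-assoc u a b) ⟩
  f (u + (a + b))  ≡⟨ per-a+b u ⟩
  f u              ∎

-- Bézout over the naturals presents the gcd as a multiple of one argument minus a multiple of the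
-- other, in one of two orders; `period-cancelʳ` performs the subtraction.
period-gcd : ∀ {f} a b → Period f (+ a) → Period f (+ b) → Period f (+ gcd a b)
period-gcd {f} a b per-a per-b with Bézout.identity (gcd-GCD a b)
... | Bézout.+- x y eq = period-cancelʳ {f} {b = + (y ℕ.* b)}
        (subst (Period f ∘ +_) (sym eq) (period-∣ per-a (∣ᵤ⇒∣ (ℕD.n∣m*n x))))
        (period-∣ per-b (∣ᵤ⇒∣ (ℕD.n∣m*n y)))
... | Bézout.-+ x y eq = period-cancelʳ {f} {b = + (x ℕ.* a)}
        (subst (Period f ∘ +_) (sym eq) (period-∣ per-b (∣ᵤ⇒∣ (ℕD.n∣m*n y))))
        (period-∣ per-a (∣ᵤ⇒∣ (ℕD.n∣m*n x)))

prime-divisor : ∀ n .{{_ : ℕ.NonZero n}} → n ≢ 1 → ∃₂ λ p m → Prime p × n ≡ p ℕ.* m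
prime-divisor n n≢1 with factorise n
... | record { factors = [] ; isFactorisation = n≡1 } = contradiction n≡1 n≢1
... | record { factors = p ∷ ps ; isFactorisation = n≡ ; factorsPrime = pp ∷ _ } =
  p , product ps , pp , n≡

module _ {N : ℕ} {{N≢0 : ℕ.NonZero N}} (pf : PrimitiveFunction N) where
  open PrimitiveFunction pf

  -- Counterpart of the geometric sum of ζ^(u + x j) over x < N.
  orbitSum : ℤ → ℤ → ℤ
  orbitSum j u = ∑ N (λ x → h (u + + x * j))

  -- Translation by `j` moves the index `x` up by one; the two ends match because `N j` is a
  -- multiple of the period `N`.
  orbitSum-period : ∀ j → Period (orbitSum j) j
  orbitSum-period j u = trans (∑-cong N shift) (∑-rotate N f fN≡f0)
    where
    f : ℕ → ℤ
    f x = h (u + + x * j)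
    shift : ∀ x → h (u + j + + x * j) ≡ f (suc x)
    shift x = cong h (trans (ℤP.+-assoc u j _) (cong (_+_ u) (sym (ℤP.suc-* (+ x) j))))
    fN≡f0 : f N ≡ f 0
    fN≡f0 = trans (period-∣ {h} periodic (∣m⇒∣m*n j ∣-refl) u)
                  (cong h (sym (trans (cong (_+_ u) (ℤP.*-zeroˡ j)) (ℤP.+-identityʳ u))))

  orbitSum-periodic : ∀ j → Period (orbitSum j) (+ N)
  orbitSum-periodic j u = ∑-cong N λ x →
    trans (cong h (swapʳ u (+ N) (+ x * j))) (periodic (u + + x * j))
    where
    swapʳ : ∀ a b c → a + b + c ≡ a + c + b
    swapʳ = solve-∀

  -- The orbit sum is invariant under gcd (j , N), hence under N / p for some prime p ∣ N,
  -- so p times it is a sum over i and x whose inner sum over i vanishes.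
  orbitSum-vanish : ∀ j → ¬ (+ N ∣ j) → ∀ u → orbitSum j u ≡ 0ℤ
  orbitSum-vanish j N∤j u with gcd[m,n]∣n ∣ j ∣ N
  ... | ℕD.divides q N≡qg with prime-divisor q {{q≢0}} q≢1
    where
    q≢0 : ℕ.NonZero q
    q≢0 = ℕP.m*n≢0⇒m≢0 q {{subst ℕ.NonZero N≡qg N≢0}}
    -- Here `q` is `N` divided by its gcd with `j`, so `q = 1` would mean `N ∣ j`.
    q≢1 : q ≢ 1
    q≢1 refl = N∤j (∣ᵤ⇒∣ (subst (ℕD._∣ ∣ j ∣) (sym (trans N≡qg (ℕP.*-identityˡ _))) (gcd[m,n]∣m ∣ j ∣ N)))
  ... | p , L , pp , q≡pL =
    [ (λ p≡0 → contradiction (ℤP.+-injective p≡0) (ℕ.≢-nonZero⁻¹ p {{prime⇒nonZero pp}})) , (λ eq → eq) ]′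
      (ℤP.i*j≡0⇒i≡0∨j≡0 (+ p) p*S≡0)
    where
    g = gcd ∣ j ∣ N
    M = L ℕ.* g
    N≡pM : N ≡ p ℕ.* M
    N≡pM = trans N≡qg (trans (cong (ℕ._* g) q≡pL) (ℕP.*-assoc p L g))
    S-period : Period (orbitSum j) (+ M)
    S-period = period-∣ {orbitSum j}
      (period-gcd ∣ j ∣ N (period-∣ {orbitSum j} (orbitSum-period j) m∣∣m∣) (orbitSum-periodic j))
      (∣ᵤ⇒∣ (ℕD.n∣m*n L))
    swapʳ : ∀ a b c → a + b + c ≡ a + c + b
    swapʳ = solve-∀
    p*S≡0 : + p * orbitSum j u ≡ 0ℤ
    p*S≡0 = begin
      + p * orbitSum j u
        ≡⟨ ∑-const p (orbitSum j u) ⟨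
      ∑ p (λ _ → orbitSum j u)
        ≡⟨ ∑-cong p (λ i → period-∣ {orbitSum j} S-period (∣n⇒∣m*n (+ i) ∣-refl) u) ⟨
      ∑ p (λ i → orbitSum j (u + + i * + M))
        ≡⟨ ∑-swap p N (λ i x → h (u + + i * + M + + x * j)) ⟩
      ∑ N (λ x → ∑ p (λ i → h (u + + i * + M + + x * j)))
        ≡⟨ ∑-zero N (λ x → trans (∑-cong p λ i → cong h (swapʳ u (+ i * + M) (+ x * j)))
                                 (vanish p M pp N≡pM (u + + x * j))) ⟩
      0ℤ ∎

-- Orthogonality to polynomials of low degree on the cube.

-- Orthogonal m g says that ∑ g(I) P(I) = 0 over the cube for every integer polynomial P of degree < m
-- in the coordinates of I; the clauses split off the first coordinate.
Orthogonal : (m k : ℕ) → (Subset k → ℤ) → Set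
Orthogonal zero    k       g = ⊤
Orthogonal (suc m) zero    g = g [] ≡ 0ℤ
Orthogonal (suc m) (suc k) g =
  Orthogonal (suc m) k (λ I → g (true ∷ I) + g (false ∷ I)) ×
  Orthogonal m k (λ I → g (true ∷ I)) ×
  Orthogonal m k (λ I → g (false ∷ I))

orthogonal-cong : ∀ m k {f g} → (∀ I → f I ≡ g I) → Orthogonal m k f → Orthogonal m k g
orthogonal-cong zero    k       f≗g _              = tt
orthogonal-cong (suc m) zero    f≗g o              = trans (sym (f≗g [])) o
orthogonal-cong (suc m) (suc k) f≗g (o₊ , o₁ , o₀) =
  orthogonal-cong (suc m) k (λ I → cong₂ _+_ (f≗g (true ∷ I)) (f≗g (false ∷ I))) o₊ ,
  orthogonal-cong m k (f≗g ∘ (true ∷_)) o₁ ,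
  orthogonal-cong m k (f≗g ∘ (false ∷_)) o₀

orthogonal-0 : ∀ m k → Orthogonal m k (λ _ → 0ℤ)
orthogonal-0 zero    k       = tt
orthogonal-0 (suc m) zero    = refl
orthogonal-0 (suc m) (suc k) = orthogonal-0 (suc m) k , orthogonal-0 m k , orthogonal-0 m k

orthogonal-+ : ∀ m k {f g} → Orthogonal m k f → Orthogonal m k g → Orthogonal m k (λ I → f I + g I)
orthogonal-+ zero    k       _  _  = tt
orthogonal-+ (suc m) zero    of og = cong₂ _+_ of og
orthogonal-+ (suc m) (suc k) {f} {g} (o₊ , o₁ , o₀) (o₊′ , o₁′ , o₀′) =
  orthogonal-cong (suc m) k
    (λ I → interchange (f (true ∷ I)) (f (false ∷ I)) (g (true ∷ I)) (g (false ∷ I)))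
    (orthogonal-+ (suc m) k o₊ o₊′) ,
  orthogonal-+ m k o₁ o₁′ ,
  orthogonal-+ m k o₀ o₀′
  where
  interchange : ∀ a b c d → a + b + (c + d) ≡ a + c + (b + d)
  interchange = solve-∀

orthogonal-∑ : ∀ m k n {G : ℕ → Subset k → ℤ} →
               (∀ x → Orthogonal m k (G x)) → Orthogonal m k (λ I → ∑ n (λ x → G x I))
orthogonal-∑ m k zero    os = orthogonal-0 m k
orthogonal-∑ m k (suc n) os = orthogonal-+ m k (os 0) (orthogonal-∑ m k n (os ∘ suc))

-- Counting subsets, and the least size of a support.

length-filter-map : ∀ {A B : Set} {P : Pred B 0ℓ} (P? : Decidable P) (f : A → B) xs →
                    length (filter P? (map f xs)) ≡ length (filter (P? ∘ f) xs)
length-filter-map P? f []       = refl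
length-filter-map P? f (x ∷ xs) with P? (f x)
... | yes _ = cong suc (length-filter-map P? f xs)
... | no  _ = length-filter-map P? f xs

count : ∀ {k} {P : Pred (Subset k) 0ℓ} → Decidable P → ℕ
count {k} P? = length (filter P? (allSubsets k))

count-suc : ∀ {k} {P : Pred (Subset (suc k)) 0ℓ} (P? : Decidable P) →
            count P? ≡ count (P? ∘ (true ∷_)) ℕ.+ count (P? ∘ (false ∷_))
count-suc {k} P? = begin
  length (filter P? (ts ++ fs))                        ≡⟨ cong length (filter-++ P? ts fs) ⟩
  length (filter P? ts ++ filter P? fs)                ≡⟨ length-++ (filter P? ts) ⟩
  length (filter P? ts) ℕ.+ length (filter P? fs)      ≡⟨ cong₂ ℕ._+_ (length-filter-map P? (true ∷_) (allSubsets k))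
                                                                       (length-filter-map P? (false ∷_) (allSubsets k)) ⟩
  count (P? ∘ (true ∷_)) ℕ.+ count (P? ∘ (false ∷_))   ∎
  where
  ts fs : List (Subset (suc k))
  ts = map (true ∷_) (allSubsets k)
  fs = map (false ∷_) (allSubsets k)

cube-cases : ∀ {k} {Q : Subset (suc k) → Set} →
             (∀ I → Q (true ∷ I)) → (∀ I → Q (false ∷ I)) → ∀ I → Q I
cube-cases t f (true  ∷ I) = t I
cube-cases t f (false ∷ I) = f I

-- Integer analogue of the minimum distance of a Reed-Muller code, by induction on the dimension. If
-- neither face is found to vanish, each contributes `2 ^ m` points; if one vanishes, the other
-- equals the sum of the faces and so inherits orthogonality at the full level `suc m`.
support-bound : ∀ m k (g : Subset k → ℤ) {P : Pred (Subset k) 0ℓ} (P? : Decidable P) →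
                (∀ I → ¬ P I → g I ≡ 0ℤ) → Orthogonal m k g →
                (∀ I → g I ≡ 0ℤ) ⊎ 2 ^ m ≤ count P?
support-bound zero zero g P? supp _ with P? []
... | yes _  = inj₂ (s≤s z≤n)
... | no  ¬p = inj₁ λ where [] → supp [] ¬p
support-bound (suc m) zero g P? supp o = inj₁ λ where [] → o
support-bound zero (suc k) g P? supp _ rewrite count-suc P?
  with support-bound zero k _ (P? ∘ (true ∷_)) (supp ∘ (true ∷_)) tt
     | support-bound zero k _ (P? ∘ (false ∷_)) (supp ∘ (false ∷_)) tt
... | inj₂ b₁ | _       = inj₂ (ℕP.≤-trans b₁ (ℕP.m≤m+n _ _))
... | inj₁ z₁ | inj₂ b₀ = inj₂ (ℕP.≤-trans b₀ (ℕP.m≤n+m _ _))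
... | inj₁ z₁ | inj₁ z₀ = inj₁ (cube-cases z₁ z₀)
support-bound (suc m) (suc k) g P? supp (o₊ , o₁ , o₀) rewrite count-suc P?
  with support-bound m k _ (P? ∘ (true ∷_)) (supp ∘ (true ∷_)) o₁
     | support-bound m k _ (P? ∘ (false ∷_)) (supp ∘ (false ∷_)) o₀
-- `2 ^ suc m` unfolds to `2 ^ m + (2 ^ m + 0)`.
... | inj₂ b₁ | inj₂ b₀ = inj₂ (ℕP.+-mono-≤ b₁ (subst (_≤ _) (sym (ℕP.+-identityʳ (2 ^ m))) b₀))
... | inj₁ z₁ | _
  -- With the `true` face zero, `o₊` is a statement about the `false` face alone, stronger by one
  -- degree than `o₀`.
  with support-bound (suc m) k _ (P? ∘ (false ∷_)) (supp ∘ (false ∷_))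
         (orthogonal-cong (suc m) k (λ I → trans (cong (_+ g (false ∷ I)) (z₁ I)) (ℤP.+-identityˡ _)) o₊)
...   | inj₁ z₀ = inj₁ (cube-cases z₁ z₀)
...   | inj₂ b₀ = inj₂ (ℕP.≤-trans b₀ (ℕP.m≤n+m _ _))
support-bound (suc m) (suc k) g P? supp (o₊ , o₁ , o₀) | inj₂ b₁ | inj₁ z₀
  with support-bound (suc m) k _ (P? ∘ (true ∷_)) (supp ∘ (true ∷_))
         (orthogonal-cong (suc m) k (λ I → trans (cong (_+_ (g (true ∷ I))) (z₀ I)) (ℤP.+-identityʳ _)) o₊)
...   | inj₁ z₁ = inj₁ (cube-cases z₁ z₀)
...   | inj₂ b₁′ = inj₂ (ℕP.≤-trans b₁′ (ℕP.m≤m+n _ _))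

-- Signed functions of subset sums and their orthogonality.

sign : ∀ {k} → Subset k → ℤ
sign []          = 1ℤ
sign (true  ∷ I) = - sign I
sign (false ∷ I) = sign I

subsetSum : ∀ {k} → Subset k → (Fin k → ℤ) → ℤ
subsetSum []          e = 0ℤ
subsetSum (true  ∷ I) e = e zero + subsetSum I (e ∘ suc)
subsetSum (false ∷ I) e = subsetSum I (e ∘ suc)

-- For H(u) = ζ^u these are, up to a constant, the coefficients of the product of the factors 1 -
-- ζ^(e_s) X_s, and each `s` whose `e s` is a period makes its two faces cancel. The parameters `c`
-- and `w` absorb the sign and the exponent of a chosen first coordinate, and `a` keeps the filtered
-- list a `tabulate` in the recursion.
alternating-orthogonal :
  ∀ m k {H : ℤ → ℤ} {A : Set} {P : Pred A 0ℓ} (P? : Decidable P) (a : Fin k → A) (e : Fin k → ℤ) →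
  (∀ s → P (a s) → Period H (e s)) → m ≤ length (filter P? (tabulate a)) →
  ∀ c w → Orthogonal m k (λ I → c * (sign I * H (w + subsetSum I e)))
alternating-orthogonal zero    k             P? a e per m≤ c w = tt
alternating-orthogonal (suc m) (suc k) {H}   P? a e per m≤ c w with P? (a zero)
... | yes p =
  -- The faces cancel because `e zero` is a period. This uses up one good coordinate, and the faces
  -- themselves are only required to be orthogonal at level `m`.
  orthogonal-cong (suc m) k cancel (orthogonal-0 (suc m) k) ,
  orthogonal-cong m k (λ I → true-term c w (e zero) (sign I) (subsetSum I (e ∘ suc)))
    (alternating-orthogonal m k P? (a ∘ suc) (e ∘ suc) (per ∘ suc) (s≤s⁻¹ m≤) (- c) (w + e zero)) ,
  alternating-orthogonal m k P? (a ∘ suc) (e ∘ suc) (per ∘ suc) (s≤s⁻¹ m≤) c w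
  where
  true-term : ∀ c w e₀ s S → - c * (s * H (w + e₀ + S)) ≡ c * (- s * H (w + (e₀ + S)))
  true-term c w e₀ s S = trans (cong (λ z → - c * (s * H z)) (ℤP.+-assoc w e₀ S)) (negate c s (H (w + (e₀ + S))))
    where
    negate : ∀ c s x → - c * (s * x) ≡ c * (- s * x)
    negate = solve-∀
  cancel : ∀ I → 0ℤ ≡ c * (- sign I * H (w + (e zero + subsetSum I (e ∘ suc)))) + c * (sign I * H (w + subsetSum I (e ∘ suc)))
  cancel I = sym (trans (cong (λ z → c * (- sign I * z) + c * (sign I * H (w + S))) invariant)
                        (opposite c (sign I) (H (w + S))))
    where
    S = subsetSum I (e ∘ suc)
    opposite : ∀ c s x → c * (- s * x) + c * (s * x) ≡ 0ℤ
    opposite = solve-∀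
    swap : ∀ w e S → w + (e + S) ≡ w + S + e
    swap = solve-∀
    invariant : H (w + (e zero + S)) ≡ H (w + S)
    invariant = trans (cong H (swap w (e zero) S)) (per zero p (w + S))
... | no _ =
  -- Both faces keep all the good coordinates, so each is orthogonal at level `suc m`, and hence so
  -- is their sum.
  orthogonal-+ (suc m) k (orthogonal-cong (suc m) k (true-term {c}) (rec (suc m) m≤ (- c) (w + e zero))) (rec (suc m) m≤ c w) ,
  orthogonal-cong m k (true-term {c}) (rec m m≤′ (- c) (w + e zero)) ,
  rec m m≤′ c w
  where
  m≤′ : m ≤ length (filter P? (tabulate (a ∘ suc)))
  m≤′ = ℕP.≤-trans (ℕP.n≤1+n m) m≤
  rec : ∀ m → m ≤ length (filter P? (tabulate (a ∘ suc))) →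
        ∀ c w → Orthogonal m k (λ I → c * (sign I * H (w + subsetSum I (e ∘ suc))))
  rec m m≤ = alternating-orthogonal m k P? (a ∘ suc) (e ∘ suc) (per ∘ suc) m≤
  true-term : ∀ {c} I → - c * (sign I * H (w + e zero + subsetSum I (e ∘ suc))) ≡ c * (- sign I * H (w + (e zero + subsetSum I (e ∘ suc))))
  true-term {c} I = trans (cong (λ z → - c * (sign I * H z)) (ℤP.+-assoc w (e zero) _)) (negate c (sign I) (H (w + (e zero + subsetSum I (e ∘ suc)))))
    where
    negate : ∀ c s x → - c * (s * x) ≡ c * (- s * x)
    negate = solve-∀

-- Makes the exponent affine in `x`, so that summation over `x` becomes an orbit sum.
subsetSum-affine : ∀ {k} (I : Subset k) x (a d : Fin k → ℤ) →
                   subsetSum I (λ s → (x - a s) * d s) ≡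
                   x * subsetSum I d - subsetSum I (λ s → a s * d s)
subsetSum-affine []          x a d = sym (trans (ℤP.+-identityʳ (x * 0ℤ)) (ℤP.*-zeroʳ x))
subsetSum-affine (true  ∷ I) x a d =
  trans (cong (_+_ ((x - a zero) * d zero)) (subsetSum-affine I x (a ∘ suc) (d ∘ suc)))
        (collect x (a zero) (d zero) (subsetSum I (d ∘ suc)) (subsetSum I (λ s → a (suc s) * d (suc s))))
  where
  collect : ∀ x a d D A → (x - a) * d + (x * D - A) ≡ x * (d + D) - (a * d + A)
  collect = solve-∀
subsetSum-affine (false ∷ I) x a d = subsetSum-affine I x (a ∘ suc) (d ∘ suc)

sign≢0 : ∀ {k} (I : Subset k) → sign I ≢ 0ℤ
sign≢0 []          ()
sign≢0 (true  ∷ I) -s≡0 = sign≢0 I (trans (sym (ℤP.neg-involutive (sign I))) (cong -_ -s≡0))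
sign≢0 (false ∷ I) = sign≢0 I

-- Rational subset sums over a common denominator.

does-∈? : ∀ {k} (I : Subset k) s → does (s ∈? I) ≡ lookup I s
does-∈? (true  ∷ I) zero    = refl
does-∈? (false ∷ I) zero    = refl
does-∈? (_     ∷ I) (suc s) = does-∈? I s

-- `sumOver` filters `tabulate id`; a general `a` makes the tail again an instance. Membership
-- enters only through its Boolean, so that it can be compared with the entries of `I`.
foldr-filter-tabulate :
  ∀ k {A : Set} {P : Pred A 0ℓ} (P? : Decidable P) (a : Fin k → A) (f : A → ℚ)
  (I : Subset k) (d : Fin k → ℤ) n →
  (∀ s → does (P? (a s)) ≡ lookup I s) → (∀ s → f (a s) ≡ d s ℚ./ suc n) →
  foldr (λ s acc → f s ℚ.+ acc) 0ℚ (filter P? (tabulate a)) ≡ subsetSum I d ℚ./ suc n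
foldr-filter-tabulate zero    P? a f []      d n mem eq = sym (ℚP.0/n≡0 (suc n))
foldr-filter-tabulate (suc k) P? a f (b ∷ I) d n mem eq
  with does (P? (a zero)) | mem zero
     | foldr-filter-tabulate k P? (a ∘ suc) f I (d ∘ suc) n (mem ∘ suc) (eq ∘ suc)
... | true  | refl | ih = trans (cong₂ ℚ._+_ (eq zero) ih) (/-distrib-+ (d zero) _ n)
... | false | refl | ih = ih

sumOver-/ : ∀ {k} (I : Subset k) (f : Fin k → ℚ) (d : Fin k → ℤ) n →
            (∀ s → f s ≡ d s ℚ./ suc n) → sumOver I f ≡ subsetSum I d ℚ./ suc n
sumOver-/ I f d n = foldr-filter-tabulate _ (_∈? I) id f I d n (does-∈? I)

frac-/-cong : ∀ i j n → + suc n ∣ i - j → frac (i ℚ./ suc n) ≡ frac (j ℚ./ suc n)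
frac-/-cong i j n (divides z i-j≡zn) = begin
  frac (i ℚ./ suc n)                           ≡⟨ cong (λ l → frac (l ℚ./ suc n)) i≡j+zn ⟩
  frac ((j + z * + suc n) ℚ./ suc n)           ≡⟨ cong frac (/-distrib-+ j (z * + suc n) n) ⟨
  frac (j ℚ./ suc n ℚ.+ (z * + suc n) ℚ./ suc n) ≡⟨ cong (λ q → frac (j ℚ./ suc n ℚ.+ q))
                                                     (/-cross (z * + suc n) z n 0 (ℤP.*-identityʳ _)) ⟩
  frac (j ℚ./ suc n ℚ.+ z ℚ./ 1)               ≡⟨ frac-+-integer (j ℚ./ suc n) z ⟩
  frac (j ℚ./ suc n)                           ∎
  where
  split : ∀ i j → i ≡ j + (i - j)
  split = solve-∀
  i≡j+zn : i ≡ j + z * + suc n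
  i≡j+zn = trans (split i j) (cong (_+_ j) i-j≡zn)

-- The auxiliary function of a residue system and the final count.

empty-or-witness : ∀ {A : Set} {P : Pred A 0ℓ} (P? : Decidable P) xs →
                   length (filter P? xs) ≡ 0 ⊎ ∃ P
empty-or-witness P? xs with filter P? xs | all-filter P? xs
... | []    | []     = inj₁ refl
... | x ∷ _ | px ∷ _ = inj₂ (x , px)

-- The multiple is the product of the moduli, presented as `suc N` to serve as a denominator; from
-- here on the modulus is `suc N`, not `N`.
common-multiple : ∀ {k} (n : Fin k → ℕ) → (∀ s → 0 < n s) →
                  ∃ λ N → ∀ s → n s ℕD.∣ suc N
common-multiple n n>0 with product (tabulate n) in eq
  | product≢0 (tabulate⁺ {f = n} (λ s → ℕ.>-nonZero (n>0 s)))
... | suc N | _ = N , λ s → subst (n s ℕD.∣_) eq (∈⇒∣product (∈-tabulate⁺ s))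

module _ {k N : ℕ} (a : Fin k → ℤ) (n : Fin k → ℕ) (ms : Fin k → ℤ)
         (n>0 : ∀ s → 0 < n s) (n∣N : ∀ s → n s ℕD.∣ suc N) where

  private
    q : Fin k → ℕ
    q s = ℕD.quotient (n∣N s)

    N≡q*n : ∀ s → + suc N ≡ + q s * + n s
    N≡q*n s = trans (cong +_ (ℕD._∣_.equality (n∣N s))) (ℤP.pos-* (q s) (n s))

    d : Fin k → ℤ
    d s = ms s * + q s

    m/n≡d/N : ∀ s → ms s /ᵣ n s ≡ d s ℚ./ suc N
    m/n≡d/N s with n s | n>0 s | N≡q*n s
    ... | suc n-1 | _ | N≡ = /-cross (ms s) (d s) n-1 N
      (trans (cong (_*_ (ms s)) N≡) (sym (ℤP.*-assoc (ms s) (+ q s) (+ suc n-1))))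

    D A : Subset k → ℤ
    D I = subsetSum I d
    A I = subsetSum I (λ s → a s * d s)

    -- The factor `n s` of `x - a s` cancels the denominator in d_s = m_s (N + 1) / n_s. Thus every
    -- class containing `x` supplies a period of `h`.
    covered⇒divisible : ∀ x s → + n s ∣ x - a s → + suc N ∣ (x - a s) * d s
    covered⇒divisible x s (divides c eq) = divides (c * ms s) (begin
      (x - a s) * d s                  ≡⟨ cong (_* d s) eq ⟩
      c * + n s * (ms s * + q s)       ≡⟨ rearrange c (+ n s) (ms s) (+ q s) ⟩
      c * ms s * (+ q s * + n s)       ≡⟨ cong (_*_ (c * ms s)) (N≡q*n s) ⟨
      c * ms s * + suc N               ∎)
      where
      rearrange : ∀ c n m q → c * n * (m * q) ≡ c * m * (q * n)
      rearrange = solve-∀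

    pf : PrimitiveFunction (suc N)
    pf = primitiveFunction (suc N)

    open PrimitiveFunction pf

    -- The offset `A I₀` brings the argument of `h` to 0 at `I = I₀` for every `x`, since `h` is
    -- only known to be nonzero at 0. The factor `1ℤ` is the initial `c` of
    -- `alternating-orthogonal`.
    term : Subset k → ℕ → Subset k → ℤ
    term I₀ x I = 1ℤ * (sign I * h (A I₀ - + x * D I₀ + subsetSum I (λ s → (+ x - a s) * d s)))

    g : Subset k → Subset k → ℤ
    g I₀ I = ∑ (suc N) (λ x → term I₀ x I)

    -- Collecting the powers of `x` turns the exponent into a progression of step `D I - D I₀`,
    -- whose orbit sum vanishes unless `suc N` divides the step.
    g≡ : ∀ I₀ I → g I₀ I ≡ sign I * orbitSum pf (D I - D I₀) (A I₀ - A I)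
    g≡ I₀ I = trans (∑-cong (suc N) step) (∑-*ˡ (suc N) (sign I) (λ x → h (A I₀ - A I + + x * (D I - D I₀))))
      where
      collect : ∀ x D₀ A₀ D A → A₀ - x * D₀ + (x * D - A) ≡ A₀ - A + x * (D - D₀)
      collect = solve-∀
      step : ∀ x → term I₀ x I ≡ sign I * h (A I₀ - A I + + x * (D I - D I₀))
      step x = trans (ℤP.*-identityˡ _) (cong (λ z → sign I * h z)
        (trans (cong (_+_ (A I₀ - + x * D I₀)) (subsetSum-affine I (+ x) a d))
               (collect (+ x) (D I₀) (A I₀) (D I) (A I))))

    g-diagonal : ∀ I₀ → g I₀ I₀ ≢ 0ℤ
    g-diagonal I₀ g≡0 = [ sign≢0 I₀ , [ (λ ()) , h0≢0 ]′ ∘ ℤP.i*j≡0⇒i≡0∨j≡0 (+ suc N) ]′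
      (ℤP.i*j≡0⇒i≡0∨j≡0 (sign I₀) (trans (sym g≡sN) g≡0))
      where
      cancel : ∀ A x D → A - A + x * (D - D) ≡ 0ℤ
      cancel = solve-∀
      g≡sN : g I₀ I₀ ≡ sign I₀ * (+ suc N * h 0ℤ)
      g≡sN = trans (g≡ I₀ I₀) (cong (_*_ (sign I₀))
        (trans (∑-cong (suc N) (λ x → cong h (cancel (A I₀) (+ x) (D I₀)))) (∑-const (suc N) (h 0ℤ))))

    g-support : ∀ I₀ I → ¬ (+ suc N ∣ D I - D I₀) → g I₀ I ≡ 0ℤ
    g-support I₀ I ∤ = trans (g≡ I₀ I)
      (trans (cong (_*_ (sign I)) (orbitSum-vanish pf (D I - D I₀) ∤ (A I₀ - A I))) (ℤP.*-zeroʳ (sign I)))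

    g-orthogonal : ∀ m → IsMCover m a n → ∀ I₀ → Orthogonal m k (g I₀)
    g-orthogonal m cover I₀ = orthogonal-∑ m k (suc N) λ x →
      -- For fixed `x`, `coverCount` filters `allFin k`, that is `tabulate id`, so the covering
      -- hypothesis is exactly the required count.
      alternating-orthogonal m k (λ s → + n s ∣? (+ x - a s)) id (λ s → (+ x - a s) * d s)
        (λ s n∣ → period-∣ {h} periodic (covered⇒divisible (+ x) s n∣))
        (cover (+ x)) 1ℤ (A I₀ - + x * D I₀)

  frac-sumOver-cong : ∀ I J → + suc N ∣ D I - D J →
    frac (sumOver I (λ s → ms s /ᵣ n s)) ≡ frac (sumOver J (λ s → ms s /ᵣ n s))
  frac-sumOver-cong I J N∣ = begin
    frac (sumOver I (λ s → ms s /ᵣ n s))  ≡⟨ cong frac (sumOver-/ I _ d N m/n≡d/N) ⟩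
    frac (D I ℚ./ suc N)                  ≡⟨ frac-/-cong (D I) (D J) N N∣ ⟩
    frac (D J ℚ./ suc N)                  ≡⟨ cong frac (sumOver-/ J _ d N m/n≡d/N) ⟨
    frac (sumOver J (λ s → ms s /ᵣ n s))  ∎

  inhabited⇒2^m≤countIA : ∀ m → IsMCover m a n → ∀ θ I₀ →
    frac (sumOver I₀ (λ s → ms s /ᵣ n s)) ≡ θ → 2 ^ m ≤ countIA n ms θ
  inhabited⇒2^m≤countIA m cover θ I₀ I₀∈ =
    [ (λ g≗0 → contradiction (g≗0 I₀) (g-diagonal I₀)) , id ]′
      (support-bound m k (g I₀) (λ I → frac (sumOver I (λ s → ms s /ᵣ n s)) ℚP.≟ θ)
        -- Congruent sums modulo `suc N` give equal fractional parts, so for `I` outside the family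
        -- `D I` is not congruent to `D I₀`.
        (λ I I∉ → g-support I₀ I λ N∣ → I∉ (trans (frac-sumOver-cong I I₀ N∣) I₀∈))
        (g-orthogonal m cover I₀))

theorem1p1 : (m k : ℕ) → 1 ≤ m → (a : Fin k → ℤ) → (n : Fin k → ℕ) →
    (∀ s → 0 < n s) → IsMCover m a n → (ms : Fin k → ℤ) →
    (θ : ℚ) → 0ℚ ℚ.≤ θ → θ ℚ.< 1ℚ →
    countIA n ms θ ≡ 0 ⊎ 2 ^ m ≤ countIA n ms θ
theorem1p1 m k _ a n n>0 cover ms θ _ _
  with empty-or-witness (λ I → frac (sumOver I (λ s → ms s /ᵣ n s)) ℚP.≟ θ) (allSubsets k)
... | inj₁ empty       = inj₁ empty
... | inj₂ (I₀ , I₀∈)  with N , n∣N ← common-multiple n n>0 =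
  inj₂ (inhabited⇒2^m≤countIA a n ms n>0 n∣N m cover θ I₀ I₀∈)
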